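{- For every positive integer $n$, the uniqueness property fails for the triple graph $\mathcal{T}_n$: there exist two vertices of $\mathcal{T}_n$ whose triples of integers have the same largest element but are not equal (not even up to permutation of their entries). More precisely, for every $j\ge 1$ the graph $\mathcal{T}_n$ contains vertices labelled \[ \Big(\breve K(S_n(0)),\ \breve K\big(S_n(0)^{5j+1}S_n(1)\big),\ \breve K\big(S_n(0)^{5j}S_n(1)\big)\Big) \quad\text{and}\quad \Big(\breve K\big(S_n(0)S_n(1)^{3j}\big),\ \breve K\big(S_n(0)S_n(1)^{3j+1}\big),\ \breve K(S_n(1))\Big), \] these two triples have equal largest element, and they are distinct triples.
   Context: For finite sequences of positive integers $\alpha=(a_1,\dots,a_k)$, $\beta=(b_1,\dots,b_m)$, the concatenation is $\alpha\beta=\alpha\oplus\beta=(a_1,\dots,a_k,b_1,\dots,b_m)$, and $\alpha^k$ denotes the concatenation of $k$ copies of $\alpha$. The continued fraction $[a_1;a_2:\dots:a_k]$ means $a_1+\cfrac{1}{a_2+\cfrac{1}{\ddots+\cfrac{1}{a_k}}}$. For a sequence $(a_1,\dots,a_k)$ of positive integers with $k\ge2$, the integer sine $\breve K(a_1,\dots,a_k)$ is the integer $c$ where $[a_1;a_2:\dots:a_{k-1}]=c/d$ with $\gcd(c,d)=1$, $c,d>0$ (note the last entry $a_k$ is omitted). On triples $(\alpha,\gamma,\beta)$ of finite sequences define $\mathcal L(\alpha,\gamma,\beta)=(\alpha,\alpha\gamma,\gamma)$ and $\mathcal R(\alpha,\gamma,\beta)=(\gamma,\gamma\beta,\beta)$.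 The graph $\mathcal G(\alpha,\beta)$ is the binary graph with root $(\alpha,\alpha\beta,\beta)$ whose vertices are all triples obtained from the root by finitely many applications of $\mathcal L,\mathcal R$, with an edge $(v,w)$ whenever $w=\mathcal L(v)$ or $w=\mathcal R(v)$. The triple graph of integers $X(\mathcal G(\alpha,\beta))$ is obtained by replacing each vertex $(\alpha',\gamma',\beta')$ by the integer triple $\chi(\alpha',\gamma',\beta')=(\breve K(\alpha'),\breve K(\gamma'),\breve K(\beta'))$ (and each edge $(v,w)$ by $(\chi(v),\chi(w))$). For a positive integer $n$ let $a_n=n^2+3$, $b_n=n^4+5n^2+5$, $S_n(0)=(na_n,na_n)$, $S_n(1)=(nb_n,nb_n)$, and $\mathcal T_n=X(\mathcal G(S_n(0),S_n(1)))$. -}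

module Defs where

open import Data.Fin.Base using (Fin)
open import Data.Fin.Patterns using (0F; 1F)
open import Data.Integer.Base as ℤ using (ℤ; +_; 0ℤ)
open import Data.Irrelevant using ([_])
open import Data.List.Base using (List; []; _∷_; _++_; concat; replicate; take; length)
open import Data.List.Relation.Binary.Permutation.Propositional using (_↭_)
open import Data.Nat.Base using (ℕ; NonZero; _+_; _*_; _^_; >-nonZero; z<s)
open import Data.Nat.Properties using (m*n≢0; m≤n+m; <-≤-trans)
open import Data.Product using (∃-syntax; _×_; _,_)
open import Data.Rational.Base as ℚ using (ℚ; 1/_; ↥_)
open import Data.Rational.Properties
  using (pos⇒nonZero; pos+pos⇒pos; 1/pos⇒pos; normalize-pos)
open import Data.Refinement.Base using (Refinement-syntax; value; _,_)
open import Data.Sum.Base using (_⊎_)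
open import Relation.Binary.Construct.Closure.ReflexiveTransitive using (Star)
open import Relation.Binary.PropositionalEquality using (_≡_)

ℕ⁺ : Set
ℕ⁺ = [ n ∈ ℕ ∣ NonZero n ]

Seq : Set
Seq = List ℕ⁺

infixl 8 _^^_

_^^_ : Seq → ℕ → Seq
α ^^ k = concat (replicate k α)

-- cf a₁ (a₂ ∷ … ∷ aₖ ∷ []) is [a₁; a₂ : … : aₖ].  Positivity is proved
-- simultaneously because the library's reciprocal requires a nonzero argument.

cf     : ℕ⁺ → Seq → ℚ
cf-pos : ∀ a α → ℚ.Positive (cf a α)

cf a []      = + value a ℚ./ 1
cf a (b ∷ α) = + value a ℚ./ 1 ℚ.+ (1/ cf b α) {{pos⇒nonZero (cf b α) {{cf-pos b α}}}}

cf-pos (a , [ a≢0 ]) []      = normalize-pos a 1 {{_}} {{a≢0}}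
cf-pos (a , [ a≢0 ]) (b ∷ α) =
  pos+pos⇒pos (+ a ℚ./ 1) {{normalize-pos a 1 {{_}} {{a≢0}}}}
              ((1/ cf b α) {{pos⇒nonZero (cf b α) {{cf-pos b α}}}})
              {{1/pos⇒pos (cf b α) {{cf-pos b α}}}}

-- The integer sine of (a₁, …, aₖ), k ≥ 2: the numerator of [a₁; a₂ : … : aₖ₋₁].
-- Elements of ℚ are in lowest terms with positive denominator, so ↥ is the
-- required numerator.  On sequences of length < 2, where the integer sine is not
-- defined, the value 0 is arbitrary.

K̆ : Seq → ℤ
K̆ []          = 0ℤ
K̆ (_ ∷ [])    = 0ℤ
K̆ (a ∷ b ∷ α) = ↥ cf a (take (length α) (b ∷ α))

Triple : Set → Set
Triple A = A × A × A

𝓛 𝓡 : Triple Seq → Triple Seq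
𝓛 (α , γ , β) = α , α ++ γ , γ
𝓡 (α , γ , β) = γ , γ ++ β , β

record TripleGraph (A : Set) : Set₁ where
  field
    Vertex : Triple A → Set
    Edge   : Triple A → Triple A → Set

open TripleGraph public

_⟶_ : Triple Seq → Triple Seq → Set
v ⟶ w = w ≡ 𝓛 v ⊎ w ≡ 𝓡 v

𝓖 : Seq → Seq → TripleGraph Seq
𝓖 α β = record
  { Vertex = IsVertex
  ; Edge   = λ v w → IsVertex v × IsVertex w × v ⟶ w
  }
  where
  IsVertex : Triple Seq → Set
  IsVertex = Star _⟶_ (α , α ++ β , β)

χ : Triple Seq → Triple ℤ
χ (α , γ , β) = K̆ α , K̆ γ , K̆ β

X : TripleGraph Seq → TripleGraph ℤ
X G = record
  { Vertex = λ t → ∃[ v ] (Vertex G v × χ v ≡ t)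
  ; Edge   = λ t u → ∃[ v ] ∃[ w ] (Edge G v w × χ v ≡ t × χ w ≡ u)
  }

largest : Triple ℤ → ℤ
largest (x , y , z) = x ℤ.⊔ y ℤ.⊔ z

entries : Triple ℤ → List ℤ
entries (x , y , z) = x ∷ y ∷ z ∷ []

infix 4 _≈_

_≈_ : Triple ℤ → Triple ℤ → Set
t ≈ u = entries t ↭ entries u

UniquenessProperty : TripleGraph ℤ → Set
UniquenessProperty G =
  ∀ t u → Vertex G t → Vertex G u → largest t ≡ largest u → t ≈ u

aₙ bₙ : ℕ → ℕ
aₙ n = n ^ 2 + 3
bₙ n = n ^ 4 + 5 * n ^ 2 + 5

n*a≢0 : ∀ n → .{{NonZero n}} → NonZero (n * aₙ n)
n*a≢0 n {{n≢0}} = m*n≢0 n (aₙ n) {{n≢0}}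
  {{>-nonZero (<-≤-trans z<s (m≤n+m 3 (n ^ 2)))}}

n*b≢0 : ∀ n → .{{NonZero n}} → NonZero (n * bₙ n)
n*b≢0 n {{n≢0}} = m*n≢0 n (bₙ n) {{n≢0}}
  {{>-nonZero (<-≤-trans z<s (m≤n+m 5 (n ^ 4 + 5 * n ^ 2)))}}

S : (n : ℕ) → .{{NonZero n}} → Fin 2 → Seq
S n 0F = (n * aₙ n , [ n*a≢0 n ]) ∷ (n * aₙ n , [ n*a≢0 n ]) ∷ []
S n 1F = (n * bₙ n , [ n*b≢0 n ]) ∷ (n * bₙ n , [ n*b≢0 n ]) ∷ []

𝓣 : (n : ℕ) → .{{NonZero n}} → TripleGraph ℤ
𝓣 n = X (𝓖 (S n 0F) (S n 1F))

leftTriple rightTriple : (n : ℕ) → .{{NonZero n}} → ℕ → Triple ℤ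
leftTriple n j =
  K̆ (S n 0F) , K̆ (S n 0F ^^ (5 * j + 1) ++ S n 1F) , K̆ (S n 0F ^^ (5 * j) ++ S n 1F)
rightTriple n j =
  K̆ (S n 0F ++ S n 1F ^^ (3 * j)) , K̆ (S n 0F ++ S n 1F ^^ (3 * j + 1)) , K̆ (S n 1F)

{-# OPTIONS --safe #-}

-- Replace integer sines by continuants: K̆ (α, y, z) is the continuant of (α, y).
-- Let F k be the k-th Fibonacci polynomial at n, so F (k + 2) = n F (k + 1) + F k.
-- Then x = n aₙ and y = n bₙ are the third and fifth Lucas polynomials, whence
-- F (m + 6) = x F (m + 3) + F m and F (m + 10) = y F (m + 5) + F m.  This gives
--   F 3 · K (xᵏ, y) = y F (3k + 3) + F (3k),   F 5 · K (yᵏ) = F (5k + 5),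
-- so both middle entries are combinations of F (30j + 5) and F (30j + 6), and their
-- equality becomes a polynomial identity.  Continuants grow under extension, so the
-- middle entries are the largest; x occurs on the left but is smaller than every
-- entry on the right.

module Submission where

open import Defs
open import Data.Fin.Patterns using (0F; 1F)
open import Data.Integer.Base as ℤ using (ℤ; +_; +<+)
import Data.Integer.Properties as ℤ
open import Data.Irrelevant using ([_])
open import Data.List.Base as List using ([]; _∷_; _++_; replicate; take; length)
open import Data.List.Properties using (++-assoc; ++-identityʳ)
open import Data.List.Relation.Binary.Permutation.Propositional using (↭-reflexive)
open import Data.List.Relation.Binary.Permutation.Propositional.Properties using (∈-resp-↭)
import Data.List.Relation.Unary.All as All
open All using (All; []; _∷_)
open import Data.List.Relation.Unary.Any using (here)
open import Data.Nat.Base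
  using (ℕ; zero; suc; NonZero; _+_; _*_; _^_; _≤_; _<_; _⊔_; >-nonZero; >-nonZero⁻¹; z<s; s≤s)
open import Data.Nat.Coprimality as Coprime using (Coprime; 1-coprimeTo)
open import Data.Nat.Divisibility using (∣m+n∣m⇒∣n; ∣n⇒∣m*n)
open import Data.Nat.Properties
open import Data.Nat.Solver using (module +-*-Solver)
open import Data.Product using (∃-syntax; _×_; _,_; proj₁)
open import Data.Rational.Base as ℚ using (ℚ; mkℚ; 1/_; ↥_; ↧ₙ_)
open import Data.Rational.Properties using (normalize-coprime; /-cong; pos⇒nonZero)
open import Data.Refinement.Base using (value; _,_)
open import Data.Sum.Base using (inj₁; inj₂)
open import Function.Base using (_∘_)
open import Relation.Binary.Construct.Closure.ReflexiveTransitive using (ε; _◅_; _◅◅_)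
open import Relation.Binary.PropositionalEquality
open import Relation.Nullary.Negation using (¬_)
open +-*-Solver using (Polynomial; con; _:+_; _:*_; _:^_; _:=_; solve)

-- Continuants

K : Seq → ℕ
K []          = 1
K (a ∷ [])    = value a
K (a ∷ b ∷ α) = value a * K (b ∷ α) + K α

0<value : ∀ a → 0 < value a
0<value (a , [ a≢0 ]) = >-nonZero⁻¹ a {{a≢0}}

K≤K-∷ : ∀ a α → K α ≤ K (a ∷ α)
K≤K-∷ a []      = 0<value a
K≤K-∷ a (b ∷ α) = ≤-trans (m≤n*m (K (b ∷ α)) (value a) {{>-nonZero (0<value a)}}) (m≤m+n _ (K α))

K≤K-∷∷ : ∀ a b α → K α ≤ K (a ∷ b ∷ α)
K≤K-∷∷ a b α = ≤-trans (K≤K-∷ b α) (K≤K-∷ a (b ∷ α))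

K≤K-++ : ∀ α β → K α ≤ K (α ++ β)
K≤K-++ []          []      = ≤-refl
K≤K-++ []          (b ∷ β) = ≤-trans (K≤K-++ [] β) (K≤K-∷ b β)
K≤K-++ (a ∷ [])    []      = ≤-refl
K≤K-++ (a ∷ [])    (b ∷ β) = ≤-trans
  (m≤m*n (value a) (K (b ∷ β)) {{>-nonZero (≤-trans (K≤K-++ [] β) (K≤K-∷ b β))}})
  (m≤m+n _ (K β))
K≤K-++ (a ∷ b ∷ α) β       =
  +-mono-≤ (*-monoʳ-≤ (value a) (K≤K-++ (b ∷ α) β)) (K≤K-++ α β)

-- Euclid's algorithm: by the recurrence, a common divisor of two successive continuants also
-- divides the next shorter one.
K-coprime : ∀ a α → Coprime (K (a ∷ α)) (K α)
K-coprime a []      = Coprime.sym (1-coprimeTo (value a))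
K-coprime a (b ∷ α) (d∣aP+Q , d∣P) =
  K-coprime b α (d∣P , ∣m+n∣m⇒∣n d∣aP+Q (∣n⇒∣m*n (value a) d∣P))

-- Continued fractions as quotients of continuants in lowest terms

HasFraction : ℚ → ℕ → ℕ → Set
HasFraction p m d = ↥ p ≡ + m × ↧ₙ p ≡ d

/-hasFraction : ∀ {m d} .{{_ : NonZero d}} → Coprime m d → HasFraction (+ m ℚ./ d) m d
/-hasFraction {d = suc _} c = cong ↥_ (normalize-coprime c) , cong ↧ₙ_ (normalize-coprime c)

1/-hasFraction : ∀ {p m d} .{{_ : ℚ.NonZero p}} → HasFraction p m d → HasFraction (1/ p) d m
1/-hasFraction {mkℚ (+ suc _) _ _} (refl , refl) = refl , refl

-- Addition in ℚ renormalises by a gcd; coprimality of the result makes this harmless, and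
-- `K-coprime` supplies it for continuants.
+-hasFraction : ∀ {p q a m d} → HasFraction p a 1 → HasFraction q m d →
                Coprime (a * d + m) d → HasFraction (p ℚ.+ q) (a * d + m) d
+-hasFraction {p@(mkℚ _ _ _)} {q@(mkℚ _ d-1 _)} {a} {m} (refl , refl) (refl , refl) c =
  subst (λ r → HasFraction r (a * suc d-1 + m) (suc d-1)) (sym p+q≡) (/-hasFraction c)
  where
  p+q≡ : p ℚ.+ q ≡ + (a * suc d-1 + m) ℚ./ suc d-1
  p+q≡ = /-cong
    (cong₂ ℤ._+_ (sym (ℤ.pos-* a (suc d-1))) (ℤ.*-identityʳ (+ m)))
    (*-identityˡ (suc d-1))

cf-hasFraction : ∀ a α → HasFraction (cf a α) (K (a ∷ α)) (K α)
cf-hasFraction a []      = /-hasFraction (K-coprime a [])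
cf-hasFraction a (b ∷ α) = +-hasFraction {+ value a ℚ./ 1} {(1/ cf b α) {{cf≢0}}}
  (/-hasFraction (K-coprime a []))
  (1/-hasFraction {cf b α} {{cf≢0}} (cf-hasFraction b α))
  (K-coprime a (b ∷ α))
  where cf≢0 = pos⇒nonZero (cf b α) {{cf-pos b α}}

take-init : ∀ (α : Seq) y z → take (length (α ++ List.[ y ])) (α ++ y ∷ z ∷ []) ≡ α ++ List.[ y ]
take-init []      y z = refl
take-init (a ∷ α) y z = cong (a ∷_) (take-init α y z)

length-snoc : ∀ (α : Seq) y z → length (α ++ y ∷ z ∷ []) ≡ suc (length (α ++ List.[ y ]))
length-snoc []      y z = refl
length-snoc (a ∷ α) y z = cong suc (length-snoc α y z)

K̆-continuant : ∀ α y z → K̆ (α ++ y ∷ z ∷ []) ≡ + K (α ++ List.[ y ])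
K̆-continuant []          y z = proj₁ (cf-hasFraction y [])
K̆-continuant (a ∷ [])    y z = proj₁ (cf-hasFraction a List.[ y ])
-- `length-snoc` exposes the successor with which `take` keeps b; `take-init` then drops exactly z.
K̆-continuant (a ∷ b ∷ α) y z rewrite length-snoc α y z | take-init α y z =
  proj₁ (cf-hasFraction a (b ∷ α ++ List.[ y ]))

-- Powers of sequences

^^-snoc : ∀ α k → α ^^ k ++ α ≡ α ^^ suc k
^^-snoc α zero    = sym (++-identityʳ α)
^^-snoc α (suc k) = trans (++-assoc α (α ^^ k) α) (cong (α ++_) (^^-snoc α k))

-- Powers of a constant pair are constant sequences. With `k * 2` instead of `2 * k`, the successor
-- case unfolds by computation.
pair-^^ : ∀ x k → (x ∷ x ∷ []) ^^ k ≡ replicate (k * 2) x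
pair-^^ x zero    = refl
pair-^^ x (suc k) = cong (λ α → x ∷ x ∷ α) (pair-^^ x k)

replicate-snoc : ∀ k (x : ℕ⁺) → replicate k x ++ List.[ x ] ≡ x ∷ replicate k x
replicate-snoc zero    x = refl
replicate-snoc (suc k) x = cong (x ∷_) (replicate-snoc k x)

-- The path from the root uses `𝓛` alone: each step prepends one more α to the middle entry.
𝓛-vertex : ∀ α β p → Vertex (𝓖 α β) (α , α ^^ suc p ++ β , α ^^ p ++ β)
𝓛-vertex α β zero    rewrite ++-identityʳ α = ε
𝓛-vertex α β (suc p) = 𝓛-vertex α β p ◅◅
  inj₁ (cong (λ γ → α , γ , α ^^ suc p ++ β) (++-assoc α (α ^^ suc p) β)) ◅ ε

-- The path uses `𝓡` alone. It appends β on the right, whereas powers unfold on the left, hence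
-- `^^-snoc`.
𝓡-vertex : ∀ α β q → Vertex (𝓖 α β) (α ++ β ^^ q , α ++ β ^^ suc q , β)
𝓡-vertex α β zero    rewrite ++-identityʳ α | ++-identityʳ β = ε
𝓡-vertex α β (suc q) = 𝓡-vertex α β q ◅◅
  inj₂ (cong (λ γ → α ++ β ^^ suc q , γ , β)
    (sym (trans (++-assoc α (β ^^ suc q) β) (cong (α ++_) (^^-snoc β (suc q)))))) ◅ ε

-- Vertices and their labels

largest-middle : ∀ a b c → a ≤ b → c ≤ b → largest (+ a , + b , + c) ≡ + b
largest-middle a b c a≤b c≤b =
  cong +_ (trans (cong (_⊔ c) (m≤n⇒m⊔n≡n a≤b)) (m≥n⇒m⊔n≡m c≤b))

≈-reflexive : ∀ {t u} → t ≡ u → t ≈ u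
≈-reflexive = ↭-reflexive ∘ cong entries

small-entry⇒≉ : ∀ {a b c u} → All (a ℤ.<_) (entries u) → ¬ ((a , b , c) ≈ u)
small-entry⇒≉ a<u t≈u = ℤ.<-irrefl refl (All.lookup a<u (∈-resp-↭ t≈u (here refl)))

FailingPair : TripleGraph ℤ → Triple ℤ → Triple ℤ → Set
FailingPair G t u =
  Vertex G t × Vertex G u × largest t ≡ largest u × t ≢ u × ¬ (t ≈ u)

failing⇒¬uniqueness : ∀ G {t u} → FailingPair G t u → ¬ UniquenessProperty G
failing⇒¬uniqueness _ (t∈G , u∈G , largest≡ , _ , t≉u) unique =
  t≉u (unique _ _ t∈G u∈G largest≡)

triple-cong : ∀ {a a′ b b′ c c′ : ℤ} → a ≡ a′ → b ≡ b′ → c ≡ c′ →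
  _≡_ {A = Triple ℤ} (a , b , c) (a′ , b′ , c′)
triple-cong refl refl refl = refl

module _ (x y : ℕ⁺) where

  -- For α = (x, x) and β = (y, y), these are α^p β and α β^(q+1) without the last y, which the
  -- integer sine omits. Note the shift in the second exponent.
  leftSeq rightSeq : ℕ → Seq
  leftSeq p  = replicate (p * 2) x ++ List.[ y ]
  rightSeq q = x ∷ x ∷ y ∷ replicate (q * 2) y

  x≤K-left : ∀ p → value x ≤ K (leftSeq (suc p))
  x≤K-left p = K≤K-++ List.[ x ] (x ∷ leftSeq p)

  K-left-mono : ∀ p → K (leftSeq p) ≤ K (leftSeq (suc p))
  K-left-mono p = K≤K-∷∷ x x (leftSeq p)

  K-right-mono : ∀ q → K (rightSeq q) ≤ K (rightSeq (suc q))
  K-right-mono q = ≤-trans (K≤K-++ (rightSeq q) (y ∷ y ∷ []))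
    -- The new pair of y's sits at the front of the block; moved to its end, it makes the longer
    -- sequence an extension on the right.
    (≤-reflexive (cong (λ α → K (x ∷ x ∷ y ∷ α)) snoc²))
    where
    snoc² : replicate (q * 2) y ++ y ∷ y ∷ [] ≡ y ∷ y ∷ replicate (q * 2) y
    snoc² = trans (sym (++-assoc (replicate (q * 2) y) List.[ y ] List.[ y ]))
      (trans (cong (_++ List.[ y ]) (replicate-snoc (q * 2) y)) (cong (y ∷_) (replicate-snoc (q * 2) y)))

  y≤K-right : ∀ q → value y ≤ K (rightSeq q)
  y≤K-right q = ≤-trans (K≤K-++ List.[ y ] (replicate (q * 2) y)) (K≤K-∷∷ x x (y ∷ replicate (q * 2) y))

  x<K-right : ∀ q → value x < K (rightSeq q)
  x<K-right q = begin-strict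
    value x               ≤⟨ m≤m*n (value x) (value x) {{>-nonZero (0<value x)}} ⟩
    -- Strictness comes from K (x, x) = x² + 1.
    value x * value x     <⟨ m<m+n (value x * value x) z<s ⟩
    K (x ∷ x ∷ [])        ≤⟨ K≤K-++ (x ∷ x ∷ []) (y ∷ replicate (q * 2) y) ⟩
    K (rightSeq q)        ∎
    where open ≤-Reasoning

  leftLabel rightLabel : ℕ → Triple ℤ
  leftLabel p  = + value x , + K (leftSeq (suc p)) , + K (leftSeq p)
  rightLabel q = + K (rightSeq q) , + K (rightSeq (suc q)) , + value y

  largest-leftLabel : ∀ p → largest (leftLabel p) ≡ + K (leftSeq (suc p))
  largest-leftLabel p = largest-middle _ _ _ (x≤K-left p) (K-left-mono p)

  largest-rightLabel : ∀ q → largest (rightLabel q) ≡ + K (rightSeq (suc q))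
  largest-rightLabel q = largest-middle _ _ _ (K-right-mono q) (y≤K-right (suc q))

  leftLabel≉rightLabel : value x < value y → ∀ p q → ¬ (leftLabel p ≈ rightLabel q)
  leftLabel≉rightLabel x<y p q = small-entry⇒≉
    (+<+ (x<K-right q) ∷ +<+ (x<K-right (suc q)) ∷ +<+ x<y ∷ [])

K̆-pair : ∀ {α x} → α ≡ x ∷ x ∷ [] → K̆ α ≡ + value x
K̆-pair {x = x} refl = K̆-continuant [] x x

K̆-left : ∀ {α β x y} → α ≡ x ∷ x ∷ [] → β ≡ y ∷ y ∷ [] →
  ∀ p → K̆ (α ^^ p ++ β) ≡ + K (leftSeq x y p)
K̆-left {α} {β} {x} {y} refl refl p =
  trans (cong (λ γ → K̆ (γ ++ β)) (pair-^^ x p)) (K̆-continuant (replicate (p * 2) x) y y)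

K̆-right : ∀ {α β x y} → α ≡ x ∷ x ∷ [] → β ≡ y ∷ y ∷ [] →
  ∀ q → K̆ (α ++ β ^^ suc q) ≡ + K (rightSeq x y q)
K̆-right {α} {β} {x} {y} α≡xx β≡yy q = trans
  (cong K̆ append)
  (trans (K̆-continuant (x ∷ x ∷ replicate (q * 2) y) y y)
    (cong (λ γ → + K (x ∷ x ∷ γ)) (replicate-snoc (q * 2) y)))
  where
  append : α ++ β ^^ suc q ≡ x ∷ x ∷ replicate (q * 2) y ++ y ∷ y ∷ []
  -- Splitting the last copy of β off at the end exposes the final two letters for `K̆-continuant`.
  append rewrite sym (^^-snoc β q) | α≡xx | β≡yy | pair-^^ y q = refl

leftVertex rightVertex : Seq → Seq → ℕ → Triple Seq
leftVertex α β p  = α , α ^^ suc p ++ β , α ^^ p ++ β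
rightVertex α β q = α ++ β ^^ q , α ++ β ^^ suc q , β

-- Here α and β are variables so that no integer sine is ever unfolded.
module _ {α β : Seq} {x y : ℕ⁺} (α≡xx : α ≡ x ∷ x ∷ []) (β≡yy : β ≡ y ∷ y ∷ []) where

  χ-leftVertex : ∀ p → χ (leftVertex α β p) ≡ leftLabel x y p
  χ-leftVertex p = triple-cong (K̆-pair α≡xx) (K̆-left α≡xx β≡yy (suc p)) (K̆-left α≡xx β≡yy p)

  χ-rightVertex : ∀ q → χ (rightVertex α β (suc q)) ≡ rightLabel x y q
  χ-rightVertex q = triple-cong (K̆-right α≡xx β≡yy q) (K̆-right α≡xx β≡yy (suc q)) (K̆-pair β≡yy)

  failingPair : value x < value y → ∀ p q → K (leftSeq x y (suc p)) ≡ K (rightSeq x y q) → 0 < q →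
    FailingPair (X (𝓖 α β)) (χ (leftVertex α β p)) (χ (rightVertex α β q))
  -- At exponent 0 the right triple would begin with the integer sine of α, which is x itself, so x
  -- could not separate the triples.
  failingPair x<y p (suc q) K≡K _ =
      (leftVertex α β p , 𝓛-vertex α β p , refl)
    , (rightVertex α β (suc q) , 𝓡-vertex α β (suc q) , refl)
    , largest≡
    , t≉u ∘ ≈-reflexive
    , t≉u
    where
    t u : Triple ℤ
    t = χ (leftVertex α β p)
    u = χ (rightVertex α β (suc q))

    largest≡ : largest t ≡ largest u
    largest≡ = begin
      largest t                     ≡⟨ cong largest (χ-leftVertex p) ⟩
      largest (leftLabel x y p)     ≡⟨ largest-leftLabel x y p ⟩
      + K (leftSeq x y (suc p))     ≡⟨ cong +_ K≡K ⟩
      + K (rightSeq x y (suc q))    ≡⟨ largest-rightLabel x y q ⟨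
      largest (rightLabel x y q)    ≡⟨ cong largest (χ-rightVertex q) ⟨
      largest u                     ∎
      where open ≡-Reasoning

    t≉u : ¬ (t ≈ u)
    t≉u = subst₂ (λ t u → ¬ (t ≈ u)) (sym (χ-leftVertex p)) (sym (χ-rightVertex q))
      (leftLabel≉rightLabel x y x<y p q)

-- Fibonacci polynomials

F : ℕ → ℕ → ℕ
F n 0             = 0
F n 1             = 1
F n (suc (suc k)) = n * F n (suc k) + F n k

-- The cases k = 1 and k = 2 allow F 3 and F 5 to be cancelled in `K-left≡K-right`.
0<F-odd : ∀ n k → 0 < F n (1 + k * 2)
0<F-odd n zero    = z<s
0<F-odd n (suc k) = <-≤-trans (0<F-odd n k) (m≤n+m _ _)

-- The solver's image of the Fibonacci recurrence started at a and b.
fibₚ : ∀ {m} (n a b : Polynomial m) → ℕ → Polynomial m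
fibₚ n a b 0             = a
fibₚ n a b 1             = b
fibₚ n a b (suc (suc k)) = n :* fibₚ n a b (suc k) :+ fibₚ n a b k

xₚ yₚ : ∀ {m} → Polynomial m → Polynomial m
xₚ n = n :* (n :^ 2 :+ con 3)
yₚ n = n :* (n :^ 4 :+ con 5 :* n :^ 2 :+ con 5)

-- The case k = 3 of F (m + 2k) = L k · F (m + k) - (-1)^k F m, with L the Lucas polynomials. It
-- holds for every solution of the recurrence, so F m and F (m + 1) can be free variables.
F-step-6 : ∀ n m → n * aₙ n * F n (3 + m) + F n m ≡ F n (6 + m)
F-step-6 n m = solve 3
  (λ n a b → xₚ n :* fibₚ n a b 3 :+ a := fibₚ n a b 6) refl
  n (F n m) (F n (1 + m))

F-step-10 : ∀ n m → n * bₙ n * F n (5 + m) + F n m ≡ F n (10 + m)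
F-step-10 n m = solve 3
  (λ n a b → yₚ n :* fibₚ n a b 5 :+ a := fibₚ n a b 10) refl
  n (F n m) (F n (1 + m))

-- The equality of the two middle entries after multiplication by F 3 · F 5. With F (5 + m) and F (6
-- + m) as free variables, it is linear in them with coefficients polynomial in n.
F-identity : ∀ n m →
  F n 5 * (n * bₙ n * F n (9 + m) + F n (6 + m)) ≡
  F n 3 * (n * aₙ n * (n * aₙ n * F n (10 + m) + F n (5 + m)) + F n (10 + m))
F-identity n m = solve 3
  (λ n a b →
    fibₚ n (con 0) (con 1) 5 :* (yₚ n :* fibₚ n a b 4 :+ b) :=
    fibₚ n (con 0) (con 1) 3 :* (xₚ n :* (xₚ n :* fibₚ n a b 5 :+ a) :+ fibₚ n a b 5)) refl
  n (F n (5 + m)) (F n (6 + m))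

distrib-step : ∀ f x u v → f * (x * u + v) ≡ x * (f * u) + f * v
distrib-step = solve 4 (λ f x u v → f :* (x :* u :+ v) := x :* (f :* u) :+ f :* v) refl

-- Closed forms of the continuants

module _ (n : ℕ) .{{n≢0 : NonZero n}} where

  x y : ℕ⁺
  x = n * aₙ n , [ n*a≢0 n ]
  y = n * bₙ n , [ n*b≢0 n ]

  -- Both sides satisfy the same second-order recurrence in k with multiplier x: the left by
  -- definition of `K`, the right by `F-step-6`. Hence the two base cases.
  F3*K : ∀ (z : ℕ⁺) k →
    F n 3 * K (replicate k x ++ List.[ z ]) ≡ value z * F n (3 + k * 3) + F n (k * 3)
  F3*K z zero          = solve 2
    (λ f z → f :* z := z :* f :+ con 0) refl (F n 3) (value z)
  F3*K z (suc zero)    = solve 2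
    (λ n z → let f = fibₚ n (con 0) (con 1) in
      f 3 :* (xₚ n :* z :+ con 1) := z :* f 6 :+ f 3) refl n (value z)
  F3*K z (suc (suc k)) = begin
    F n 3 * (value x * K (x ∷ β) + K β)                  ≡⟨ distrib-step (F n 3) (value x) _ _ ⟩
    value x * (F n 3 * K (x ∷ β)) + F n 3 * K β          ≡⟨ cong₂ (λ u v → value x * u + v)
                                                              (F3*K z (suc k)) (F3*K z k) ⟩
    value x * (value z * F n (6 + m) + F n (3 + m))
      + (value z * F n (3 + m) + F n m)                  ≡⟨ regroup (value x) (value z) _ _ _ ⟩
    value z * (value x * F n (6 + m) + F n (3 + m))
      + (value x * F n (3 + m) + F n m)                  ≡⟨ cong₂ (λ u v → value z * u + v)
                                                              (F-step-6 n (3 + m)) (F-step-6 n m) ⟩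
    value z * F n (9 + m) + F n (6 + m)                  ∎
    where
    open ≡-Reasoning
    β = replicate k x ++ List.[ z ]
    m = k * 3
    regroup : ∀ x z u v w → x * (z * u + v) + (z * v + w) ≡ z * (x * u + v) + (x * v + w)
    regroup = solve 5 (λ x z u v w →
      x :* (z :* u :+ v) :+ (z :* v :+ w) := z :* (x :* u :+ v) :+ (x :* v :+ w)) refl

  F5*K : ∀ k → F n 5 * K (replicate k y) ≡ F n (5 + k * 5)
  F5*K zero          = *-identityʳ (F n 5)
  F5*K (suc zero)    = trans (trans (*-comm (F n 5) (value y)) (sym (+-identityʳ _))) (F-step-10 n 0)
  F5*K (suc (suc k)) = begin
    F n 5 * (value y * K (y ∷ β) + K β)          ≡⟨ distrib-step (F n 5) (value y) _ _ ⟩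
    value y * (F n 5 * K (y ∷ β)) + F n 5 * K β  ≡⟨ cong₂ (λ u v → value y * u + v)
                                                      (F5*K (suc k)) (F5*K k) ⟩
    value y * F n (10 + k * 5) + F n (5 + k * 5) ≡⟨ F-step-10 n (5 + k * 5) ⟩
    F n (15 + k * 5)                             ∎
    where
    open ≡-Reasoning
    β = replicate k y

  -- Each letter x advances the Fibonacci index by 3 and each y by 5. The exponents 5j + 1 and 3j
  -- give 6(5j + 1) = 30j + 6 and 10 · 3j = 30j, so both sides involve neighbouring indices.
  K-left≡K-right : ∀ j → K (leftSeq x y (suc (5 * j))) ≡ K (rightSeq x y (3 * j))
  K-left≡K-right j = *-cancelˡ-≡ _ _ (F n 3 * F n 5) {{>-nonZero (*-mono-≤ (0<F-odd n 1) (0<F-odd n 2))}} (begin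
    F n 3 * F n 5 * K (leftSeq x y p)                              ≡⟨ cong (_* K (leftSeq x y p)) (*-comm (F n 3) (F n 5)) ⟩
    F n 5 * F n 3 * K (leftSeq x y p)                              ≡⟨ *-assoc (F n 5) (F n 3) _ ⟩
    F n 5 * (F n 3 * K (leftSeq x y p))                            ≡⟨ cong (F n 5 *_) (F3*K y (p * 2)) ⟩
    F n 5 * (value y * F n (3 + p * 2 * 3) + F n (p * 2 * 3))      ≡⟨ cong (λ i → F n 5 * (value y * F n (3 + i) + F n i)) index₃ ⟩
    F n 5 * (value y * F n (9 + j * 30) + F n (6 + j * 30))        ≡⟨ F-identity n (j * 30) ⟩
    F n 3 * right (F n (10 + j * 30)) (F n (5 + j * 30))           ≡⟨ cong (λ i → F n 3 * right (F n (10 + i)) (F n (5 + i))) index₅ ⟨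
    F n 3 * right (F n (10 + q * 2 * 5)) (F n (5 + q * 2 * 5))     ≡⟨ cong₂ (λ u v → F n 3 * right u v) (F5*K (suc (q * 2))) (F5*K (q * 2)) ⟨
    F n 3 * right (F n 5 * K (y ∷ β)) (F n 5 * K β)                ≡⟨ cong (F n 3 *_) (factor (F n 5) (value x) _ _) ⟩
    F n 3 * (F n 5 * right (K (y ∷ β)) (K β))                      ≡⟨ *-assoc (F n 3) (F n 5) _ ⟨
    F n 3 * F n 5 * K (rightSeq x y q)                             ∎)
    where
    open ≡-Reasoning
    p = suc (5 * j)
    q = 3 * j
    β = replicate (q * 2) y
    -- The continuant recurrence for the two leading letters x; it is linear, so the factor F 5
    -- passes through it.
    right : ℕ → ℕ → ℕ
    right u v = value x * (value x * u + v) + u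
    factor : ∀ f x u v → x * (x * (f * u) + f * v) + f * u ≡ f * (x * (x * u + v) + u)
    factor = solve 4 (λ f x u v →
      x :* (x :* (f :* u) :+ f :* v) :+ f :* u := f :* (x :* (x :* u :+ v) :+ u)) refl
    index₃ : p * 2 * 3 ≡ 6 + j * 30
    index₃ = solve 1 (λ j → (con 1 :+ con 5 :* j) :* con 2 :* con 3 := con 6 :+ j :* con 30) refl j
    index₅ : q * 2 * 5 ≡ j * 30
    index₅ = solve 1 (λ j → con 3 :* j :* con 2 :* con 5 := j :* con 30) refl j

  x<y : value x < value y
  x<y = *-monoʳ-< n {{n≢0}} (begin-strict
    n ^ 2 + 3                ≤⟨ +-monoˡ-≤ 3 (m≤n*m (n ^ 2) 5) ⟩
    5 * n ^ 2 + 3            ≤⟨ +-monoˡ-≤ 3 (m≤n+m (5 * n ^ 2) (n ^ 4)) ⟩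
    n ^ 4 + 5 * n ^ 2 + 3    <⟨ +-monoʳ-< (n ^ 4 + 5 * n ^ 2) (s≤s (s≤s (s≤s z<s))) ⟩
    n ^ 4 + 5 * n ^ 2 + 5    ∎)
    where open ≤-Reasoning

-- The two families of triples in the graph of n

leftTriple≡χ : ∀ n .{{_ : NonZero n}} j →
  leftTriple n j ≡ χ (leftVertex (S n 0F) (S n 1F) (5 * j))
leftTriple≡χ n j = cong
  (λ k → K̆ (S n 0F) , K̆ (S n 0F ^^ k ++ S n 1F) , K̆ (S n 0F ^^ (5 * j) ++ S n 1F))
  (+-comm (5 * j) 1)

rightTriple≡χ : ∀ n .{{_ : NonZero n}} j →
  rightTriple n j ≡ χ (rightVertex (S n 0F) (S n 1F) (3 * j))
rightTriple≡χ n j = cong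
  (λ k → K̆ (S n 0F ++ S n 1F ^^ (3 * j)) , K̆ (S n 0F ++ S n 1F ^^ k) , K̆ (S n 1F))
  (+-comm (3 * j) 1)

leftTriple-rightTriple-failing : ∀ n .{{_ : NonZero n}} j → 1 ≤ j →
  FailingPair (𝓣 n) (leftTriple n j) (rightTriple n j)
leftTriple-rightTriple-failing n j 1≤j =
  subst₂ (FailingPair (𝓣 n)) (sym (leftTriple≡χ n j)) (sym (rightTriple≡χ n j))
    (failingPair {S n 0F} {S n 1F} {x n} {y n} refl refl (x<y n) (5 * j) (3 * j)
      (K-left≡K-right n j) (≤-trans 1≤j (m≤n*m j 3)))

theorem1 : (n : ℕ) → .{{_ : NonZero n}} →
    ¬ UniquenessProperty (𝓣 n)
    × (∃[ t ] ∃[ u ] (Vertex (𝓣 n) t × Vertex (𝓣 n) u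
    × largest t ≡ largest u × t ≢ u × ¬ (t ≈ u)))
    × ((j : ℕ) → 1 ≤ j →
    Vertex (𝓣 n) (leftTriple n j) × Vertex (𝓣 n) (rightTriple n j)
    × largest (leftTriple n j) ≡ largest (rightTriple n j)
    × leftTriple n j ≢ rightTriple n j
    × ¬ (leftTriple n j ≈ rightTriple n j))
theorem1 n =
    failing⇒¬uniqueness (𝓣 n) (leftTriple-rightTriple-failing n 1 ≤-refl)
  , (leftTriple n 1 , rightTriple n 1 , leftTriple-rightTriple-failing n 1 ≤-refl)
  , leftTriple-rightTriple-failing n
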